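{- Let $U$ be a nonempty finite set and let $f\in Cl(U)$ be a closure operation on $U$. Then the set of all antikeys of $f$ equals the family of complements of the minimal transversals of the family of minimal keys of $f$: $$Antikey(f)=\overline{Tr(Key(f))}.$$
   Context: Let $U$ be a nonempty finite set with power set $\mathcal{P}(U)$. A closure operation on $U$ is a map $f:\mathcal{P}(U)\to\mathcal{P}(U)$ such that for all $X,Y\subseteq U$: $X\subseteq f(X)$; $X\subseteq Y$ implies $f(X)\subseteq f(Y)$; and $f(f(X))=f(X)$. $Cl(U)$ is the set of all closure operations on $U$. A set $K\subseteq U$ is a key of $f$ if $f(K)=U$; a key $K$ is minimal if for every $a\in K$ the set $K\setminus\{a\}$ is not a key. $Key(f)$ is the set of all minimal keys of $f$. A set $A\subseteq U$ is an antikey of $f$ if $f(A)\neq U$ and $f(A\cup\{a\})=U$ for all $a\in U\setminus A$. $Antikey(f)$ is the set of all antikeys of $f$. For a family $\mathcal{H}$ of subsets of $U$ (a hypergraph; empty families and empty edges are allowed), a transversal of $\mathcal{H}$ is a set $T\subseteq U$ with $T\cap E\neq\emptyset$ for all $E\in\mathcal{H}$; it is minimal if no proper subset of $T$ is a transversal. $Tr(\mathcal{H})$ is the family of all minimal transversals of $\mathcal{H}$. In particular $Tr(\emptyset)=\{\emptyset\}$ and $Tr(\{\emptyset\})=\emptyset$. For a family $\mathcal{S}\subseteq\mathcal{P}(U)$, $\overline{\mathcal{S}}=\{U\setminus Y: Y\in\mathcal{S}\}$ denotes the family of complements of members of $\mathcal{S}$. -}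

module Defs where

open import Data.Fin.Subset
  using (Subset; ⊤; ⁅_⁆; _∈_; _∉_; _⊆_; _⊂_; _∪_; _∩_; _-_; ∁; Nonempty)
open import Data.Nat.Base using (ℕ)
open import Data.Product.Base using (_×_; ∃-syntax)
open import Level using (0ℓ)
open import Relation.Binary.PropositionalEquality using (_≡_; _≢_)
open import Relation.Nullary using (¬_)
open import Relation.Unary using (Pred)

-- The ground set U is Fin n, so that 𝒫(U) is Subset n and U itself, as an
-- element of 𝒫(U), is ⊤.  Subsets are Boolean vectors, hence propositional
-- equality of subsets is extensional equality.

record Cl (n : ℕ) : Set where
  field
    cl         : Subset n → Subset n
    extensive  : ∀ X → X ⊆ cl X
    monotone   : ∀ X Y → X ⊆ Y → cl X ⊆ cl Y
    idempotent : ∀ X → cl (cl X) ≡ cl X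

open Cl public

-- Families may be empty, and the empty set may be a member.
Family : ℕ → Set₁
Family n = Pred (Subset n) 0ℓ

module _ {n : ℕ} where

  IsKey : Cl n → Subset n → Set
  IsKey f K = cl f K ≡ ⊤

  -- Only the minimal keys.
  Key : Cl n → Family n
  Key f K = IsKey f K × (∀ a → a ∈ K → ¬ IsKey f (K - a))

  Antikey : Cl n → Family n
  Antikey f A = cl f A ≢ ⊤ × (∀ a → a ∉ A → cl f (A ∪ ⁅ a ⁆) ≡ ⊤)

  IsTransversal : Family n → Subset n → Set
  IsTransversal ℋ T = ∀ E → ℋ E → Nonempty (T ∩ E)

  Tr : Family n → Family n
  Tr ℋ T = IsTransversal ℋ T × (∀ S → S ⊂ T → ¬ IsTransversal ℋ S)

  -- The family of complements of the members of 𝒮, not the complement of 𝒮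
  -- in 𝒫(U).
  Complements : Family n → Family n
  Complements 𝒮 X = ∃[ Y ] (𝒮 Y × X ≡ ∁ Y)

{-# OPTIONS --safe #-}
module Submission where

-- A set T meets every minimal key exactly when ∁ T is not a key, because every
-- key contains a minimal one.  Hence the minimal transversals of Key f are the
-- complements of the maximal non-keys, and, keys being closed under supersets,
-- maximality of a non-key only has to be tested by adding single elements.

open import Defs
open import Algebra.Lattice.Properties.BooleanAlgebra using (¬-involutive)
open import Data.Bool.Properties using () renaming (_≟_ to _≟ᵇ_)
open import Data.Fin.Properties using (_≟_; any?)
open import Data.Fin.Subset
  using (Subset; ⊤; ⁅_⁆; _∈_; _⊆_; _⊂_; _∪_; _∩_; _-_; ∁)
open import Data.Fin.Subset.Induction using (Acc; acc; ⊂-wellFounded)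
open import Data.Fin.Subset.Properties
open import Data.Nat.Base using (ℕ; NonZero)
open import Data.Product.Base using (_×_; _,_; ∃-syntax)
open import Data.Sum.Base using (inj₁; inj₂; [_,_]′)
open import Data.Vec.Properties using (≡-dec)
open import Function.Base using (_∘_)
open import Relation.Binary.PropositionalEquality using (_≡_; refl; sym; subst)
open import Relation.Nullary using (¬_; Dec; yes; no)
open import Relation.Nullary.Decidable using (_×-dec_; decidable-stable)
open import Relation.Unary using (_≐_)

private
  variable
    n : ℕ

∁-involutive : (p : Subset n) → ∁ (∁ p) ≡ p
∁-involutive {n} = ¬-involutive (∪-∩-booleanAlgebra n)

x∈p⇒⁅x⁆⊆p : ∀ {x} {p : Subset n} → x ∈ p → ⁅ x ⁆ ⊆ p
x∈p⇒⁅x⁆⊆p {x = x} {p} x∈p y∈⁅x⁆ =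
  subst (_∈ p) (sym (x∈⁅y⁆⇒x≡y x y∈⁅x⁆)) x∈p

-- Removing a point from a set adds it to the complement. Since keys are closed under supersets,
-- this inclusion suffices to carry keyhood across.
∁[p-x]⊆∁p∪⁅x⁆ : ∀ (p : Subset n) x → ∁ (p - x) ⊆ ∁ p ∪ ⁅ x ⁆
∁[p-x]⊆∁p∪⁅x⁆ p x {y} y∈∁[p-x] with y ≟ x
... | yes refl = x∈p∪q⁺ (inj₂ (x∈⁅x⁆ x))
... | no y≢x   = x∈p∪q⁺ (inj₁ (x∉p⇒x∈∁p λ y∈p →
  x∈∁p⇒x∉p y∈∁[p-x] (x∈p∧x≢y⇒x∈p-y y∈p y≢x)))

module _ (f : Cl n) where

  isKey? : ∀ X → Dec (IsKey f X)
  isKey? X = ≡-dec _≟ᵇ_ (cl f X) ⊤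

  isKey-⊆ : ∀ {X Y} → X ⊆ Y → IsKey f X → IsKey f Y
  isKey-⊆ {X} {Y} X⊆Y X-key =
    ⊆-antisym ⊆⊤ (subst (_⊆ cl f Y) X-key (monotone f X Y X⊆Y))

  isKey⇒∃minimalKey : ∀ X → IsKey f X → ∃[ K ] (Key f K × K ⊆ X)
  isKey⇒∃minimalKey X = go X (⊂-wellFounded X)
    where
    go : ∀ X → Acc _⊂_ X → IsKey f X → ∃[ K ] (Key f K × K ⊆ X)
    go X (acc rec) X-key with any? (λ a → (a ∈? X) ×-dec isKey? (X - a))
    ... | no ∄a = X , (X-key , λ a a∈X X-a-key → ∄a (a , a∈X , X-a-key)) , ⊆-refl
    ... | yes (a , a∈X , X-a-key) =
      let X-a⊂X = x∈p⇒p-x⊂p a∈X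
          K , K-minimal , K⊆X-a = go (X - a) (rec X-a⊂X) X-a-key
      in K , K-minimal , ⊆-trans K⊆X-a (p⊂q⇒p⊆q X-a⊂X)

  -- A minimal key inside `∁ T` would be disjoint from `T`.
  transversal⇒∁-nonKey : ∀ {T} → IsTransversal (Key f) T → ¬ IsKey f (∁ T)
  transversal⇒∁-nonKey {T} T-transversal ∁T-key =
    let K , K-minimal , K⊆∁T = isKey⇒∃minimalKey (∁ T) ∁T-key
        _ , x∈T∩K = T-transversal K K-minimal
        x∈T , x∈K = x∈p∩q⁻ T K x∈T∩K
    in x∈∁p⇒x∉p (K⊆∁T x∈K) x∈T

  ∁-nonKey⇒transversal : ∀ {T} → ¬ IsKey f (∁ T) → IsTransversal (Key f) T
  ∁-nonKey⇒transversal {T} ∁T-nonKey K (K-key , _) =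
    -- If `K` missed `T`, it would lie in `∁ T` and make it a key.
    decidable-stable (nonempty? (T ∩ K)) λ T∩K-empty →
      ∁T-nonKey (isKey-⊆ (λ x∈K → x∉p⇒x∈∁p λ x∈T →
        T∩K-empty (_ , x∈p∩q⁺ (x∈T , x∈K))) K-key)

  antikey⇒∁∈Tr : ∀ {A} → Antikey f A → Tr (Key f) (∁ A)
  antikey⇒∁∈Tr {A} (A-nonKey , A∪a-key) =
      ∁-nonKey⇒transversal (A-nonKey ∘ subst (IsKey f) (∁-involutive A))
    , minimal
    where
    minimal : ∀ S → S ⊂ ∁ A → ¬ IsTransversal (Key f) S
    minimal S (S⊆∁A , a , a∈∁A , a∉S) S-transversal =
      -- The witness `a` of strictness lies outside both `A` and `S`, so the key `A ∪ ⁅ a ⁆` fits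
      -- inside `∁ S`.
      transversal⇒∁-nonKey S-transversal
        (isKey-⊆ A∪⁅a⁆⊆∁S (A∪a-key a (x∈∁p⇒x∉p a∈∁A)))
      where
      A∪⁅a⁆⊆∁S : A ∪ ⁅ a ⁆ ⊆ ∁ S
      A∪⁅a⁆⊆∁S = [ (λ x∈A → x∉p⇒x∈∁p λ x∈S → x∈∁p⇒x∉p (S⊆∁A x∈S) x∈A)
                 , x∈p⇒⁅x⁆⊆p (x∉p⇒x∈∁p a∉S)
                 ]′ ∘ x∈p∪q⁻ A ⁅ a ⁆

  ∈Tr⇒∁-antikey : ∀ {T} → Tr (Key f) T → Antikey f (∁ T)
  ∈Tr⇒∁-antikey {T} (T-transversal , T-minimal) =
      transversal⇒∁-nonKey T-transversal
    -- Here `a` is in `T`, so by minimality `T - a` is not a transversal. This refutes only that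
    -- `∁ (T - a)` is a non-key; decidability of keyhood makes it a key.
    , λ a a∉∁T → isKey-⊆ (∁[p-x]⊆∁p∪⁅x⁆ T a)
        (decidable-stable (isKey? (∁ (T - a)))
          (T-minimal (T - a) (x∈p⇒p-x⊂p (x∉∁p⇒x∈p a∉∁T)) ∘ ∁-nonKey⇒transversal))

theorem3p2 : (n : ℕ) .{{_ : NonZero n}} (f : Cl n) →
    Antikey f ≐ Complements (Tr (Key f))
theorem3p2 n f =
    (λ {A} A-antikey → ∁ A , antikey⇒∁∈Tr f A-antikey , sym (∁-involutive A))
  , λ { (T , T∈Tr , refl) → ∈Tr⇒∁-antikey f T∈Tr }
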